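{- The maximum size of an affine cap in $\mathbb{F}_3^n$ is $O(2.84^n)$; that is, there is a constant $K>0$ such that for every positive integer $n$, every affine cap $A\subseteq\mathbb{F}_3^n$ satisfies $|A|\leq K\cdot 2.84^n$.
   Context: $\mathbb{F}_3$ is the field with three elements. An affine cap in $\mathbb{F}_3^n$ is a subset containing no three distinct points on a common affine line; equivalently, it is a progression-free subset of $\mathbb{F}_3^n$, i.e. a subset $A$ with no three pairwise distinct $a,b,c\in A$ satisfying $a+b=2c$. -}

module Defs where

open import Data.Fin using (Fin; zero; toℕ)
open import Data.Integer using (+_)
open import Data.List using (List; length)
open import Data.List.Membership.Propositional using (_∈_)
open import Data.List.Relation.Unary.Unique.Propositional using (Unique)
import Data.Nat as ℕ
open import Data.Nat using (ℕ)
open import Data.Nat.DivMod using (_mod_)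
open import Data.Product using (_×_; ∃-syntax)
open import Data.Rational using (ℚ; _/_; +-*-rawSemiring)
open import Data.Vec using (Vec; map; replicate; zipWith)
open import Relation.Binary.PropositionalEquality using (_≡_; _≢_)
open import Relation.Nullary using (¬_)

open import Algebra.Definitions.RawSemiring +-*-rawSemiring public using (_^_)

𝔽₃ : Set
𝔽₃ = Fin 3

infixl 6 _+_ _⊕_
infixl 7 _*_ _·_

_+_ : 𝔽₃ → 𝔽₃ → 𝔽₃
x + y = (toℕ x ℕ.+ toℕ y) mod 3

_*_ : 𝔽₃ → 𝔽₃ → 𝔽₃
x * y = (toℕ x ℕ.* toℕ y) mod 3

𝔽₃^ : ℕ → Set
𝔽₃^ n = Vec 𝔽₃ n

_⊕_ : ∀ {n} → 𝔽₃^ n → 𝔽₃^ n → 𝔽₃^ n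
_⊕_ = zipWith _+_

_·_ : ∀ {n} → 𝔽₃ → 𝔽₃^ n → 𝔽₃^ n
t · v = map (t *_) v

𝟎 : ∀ {n} → 𝔽₃^ n
𝟎 = replicate _ zero

OnLine : ∀ {n} → 𝔽₃^ n → 𝔽₃^ n → 𝔽₃^ n → Set
OnLine p d x = ∃[ t ] x ≡ p ⊕ t · d

Collinear : ∀ {n} → 𝔽₃^ n → 𝔽₃^ n → 𝔽₃^ n → Set
Collinear a b c =
  ∃[ p ] ∃[ d ] d ≢ 𝟎 × OnLine p d a × OnLine p d b × OnLine p d c

-- A subset of the finite set 𝔽₃ⁿ is given by a duplicate-free list of its
-- elements, so that its cardinality is the length of the list.
record FiniteSubset (X : Set) : Set where
  constructor finiteSubset
  field
    elements : List X
    unique   : Unique elements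

open FiniteSubset public

infix 4 _∈ₛ_

_∈ₛ_ : {X : Set} → X → FiniteSubset X → Set
x ∈ₛ A = x ∈ elements A

∣_∣ : {X : Set} → FiniteSubset X → ℕ
∣ A ∣ = length (elements A)

AffineCap : ∀ {n} → FiniteSubset (𝔽₃^ n) → Set
AffineCap A = ∀ {a b c} → a ∈ₛ A → b ∈ₛ A → c ∈ₛ A →
  a ≢ b → a ≢ c → b ≢ c → ¬ Collinear a b c

fromℕ : ℕ → ℚ
fromℕ m = + m / 1

{-# OPTIONS --safe #-}
module Submission where

-- The tensor δ(x, y, z) = ∏ᵢ (1 - (xᵢ + yᵢ + zᵢ)²) is the indicator of
-- x + y + z = 0, so its restriction to a cap A is diagonal and cannot be a sum
-- of fewer than |A| slices u(x) g(y, z), u(y) g(z, x), u(z) g(x, y). As a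
-- polynomial of degree 2n, every monomial of δ has degree at most 2n/3 in one of
-- x, y, z; grouping by that factor writes δ as a sum of 3M slices, where M
-- counts the a ∈ {0, 1, 2}ⁿ with a₁ + … + aₙ ≤ 2n/3. For t ≥ 1 such an a
-- satisfies 1 ≤ ∏ᵢ t^(2 - 3aᵢ), hence M ≤ (t² + t⁻¹ + t⁻⁴)ⁿ, and t = 5/4
-- gives 2.7721ⁿ.

open import Defs using (𝔽₃; 𝔽₃^; FiniteSubset; AffineCap; ∣_∣; fromℕ; _^_; elements; unique; _⊕_; _·_; 𝟎; Collinear)
open import Defs renaming (_+_ to _+₃_; _*_ to _*₃_) using ()
open import Algebra.Bundles using (CommutativeMonoid)
import Algebra.Properties.CommutativeSemigroup as CommutativeSemigroupProperties
open import Data.Fin using (Fin; zero; suc; toℕ; punchIn)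
open import Data.Fin.Properties using (_≟_; all?; any?; punchIn-injective; punchInᵢ≢i)
open import Data.Integer using (+_)
import Data.Integer as ℤ
import Data.Integer.Properties as ℤ
open import Data.List using (List; []; _∷_; _++_; foldr; length; map; filter; cartesianProduct; cartesianProductWith; allFin)
import Data.List as List
open import Data.List.Membership.Propositional using (_∈_)
open import Data.List.Membership.Propositional.Properties using (∈-lookup; ∈-map⁺; ∈-filter⁺; ∈-cartesianProduct⁺; ∈-cartesianProductWith⁺; ∈-allFin)
open import Data.List.Properties using (length-map; length-++; map-++; map-∘)
open import Data.List.Relation.Unary.All using (All; []; _∷_)
import Data.List.Relation.Unary.All as All
open import Data.List.Relation.Unary.AllPairs using (_∷_)
open import Data.List.Relation.Unary.Any using (here; there)
open import Data.List.Relation.Unary.Unique.Propositional using (Unique)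
open import Data.Nat using (ℕ; zero; suc; NonZero; z≤n; s≤s)
import Data.Nat as ℕ
import Data.Nat.Properties as ℕ
open import Data.Nat.ListAction using (sum)
open import Data.Nat.ListAction.Properties using (sum-++)
import Data.Nat.Solver as ℕ-Solver
open import Data.Product using (_×_; _,_; ∃-syntax; proj₁)
open import Data.Rational using (ℚ; 0ℚ; _/_; _*_; _<_; _≤_)
import Data.Rational as ℚ
import Data.Rational.Properties as ℚ
import Data.Rational.Unnormalised as ℚᵘ
import Data.Rational.Unnormalised.Properties as ℚᵘ
open import Data.Sum using (_⊎_; inj₁; inj₂)
open import Data.Vec using (Vec; []; _∷_; head; tail; fromList)
import Data.Vec as Vec
import Data.Vec.Membership.Propositional as Vec
open import Data.Vec.Membership.Propositional.Properties using (∈-fromList⁺)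
import Data.Vec.Relation.Unary.Any as VecAny
open import Data.Vec.Properties using (≡-dec)
open import Function using (_∘_)
open import Relation.Binary.PropositionalEquality using (_≡_; _≢_; refl; sym; trans; cong; cong₂; subst; module ≡-Reasoning)
open import Relation.Nullary using (Dec; yes; no; ¬?; contradiction)
open import Relation.Nullary.Decidable using (from-yes; decidable-stable; _→-dec_)

private
  variable
    V W : Set
    n r : ℕ

-- Arithmetic in 𝔽₃, decided by exhaustive search.

0₃ 1₃ 2₃ : 𝔽₃
0₃ = zero
1₃ = suc zero
2₃ = suc (suc zero)

infixl 6 _-₃_

_-₃_ : 𝔽₃ → 𝔽₃ → 𝔽₃
a -₃ b = a +₃ 2₃ *₃ b

*-zeroʳ : ∀ a → a *₃ 0₃ ≡ 0₃
*-zeroʳ = from-yes (all? λ a → a *₃ 0₃ ≟ 0₃)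

+-identityˡ : ∀ a → 0₃ +₃ a ≡ a
+-identityˡ = from-yes (all? λ a → 0₃ +₃ a ≟ a)

+-identityʳ : ∀ a → a +₃ 0₃ ≡ a
+-identityʳ = from-yes (all? λ a → a +₃ 0₃ ≟ a)

*-distribˡ-+ : ∀ a b c → a *₃ (b +₃ c) ≡ a *₃ b +₃ a *₃ c
*-distribˡ-+ = from-yes (all? λ a → all? λ b → all? λ c →
  a *₃ (b +₃ c) ≟ a *₃ b +₃ a *₃ c)

*-rotate : ∀ a b c → a *₃ (b *₃ c) ≡ b *₃ (c *₃ a)
*-rotate = from-yes (all? λ a → all? λ b → all? λ c →
  a *₃ (b *₃ c) ≟ b *₃ (c *₃ a))

*-interchange : ∀ a b c d → (a *₃ b) *₃ (c *₃ d) ≡ (a *₃ c) *₃ (b *₃ d)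
*-interchange = from-yes (all? λ a → all? λ b → all? λ c → all? λ d →
  (a *₃ b) *₃ (c *₃ d) ≟ (a *₃ c) *₃ (b *₃ d))

collect-slices : ∀ u g t g′ t′ →
  (u *₃ g +₃ t) +₃ (u *₃ g′ +₃ t′) ≡ u *₃ (g +₃ g′) +₃ (t +₃ t′)
collect-slices = from-yes (all? λ u → all? λ g → all? λ t → all? λ g′ → all? λ t′ →
  (u *₃ g +₃ t) +₃ (u *₃ g′ +₃ t′) ≟ u *₃ (g +₃ g′) +₃ (t +₃ t′))

nonzero-product : ∀ a b → a *₃ b ≢ 0₃ → a ≢ 0₃ × b ≢ 0₃
nonzero-product a b ab≢0 = (λ { refl → ab≢0 refl }) , λ { refl → ab≢0 (*-zeroʳ a) }

-- Tensors in three variables and slice decompositions.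

Tensor : Set → Set
Tensor V = V → V → V → 𝔽₃

data Axis : Set where
  1st 2nd 3rd : Axis

Factor : Set → Set
Factor V = Axis × (V → 𝔽₃)

-- The arguments of g are kept in cyclic order, so that rotating a slice does
-- not change g.
slice : Factor V → (V → V → 𝔽₃) → Tensor V
slice (1st , u) g x y z = u x *₃ g y z
slice (2nd , u) g x y z = u y *₃ g z x
slice (3rd , u) g x y z = u z *₃ g x y

-- The factors are fixed and only the complementary functions g vary, so these tensors form a linear
-- space. Membership witnesses slice rank at most `r`.
Span : Vec (Factor V) r → Tensor V → Set
Span []       T = ∀ x y z → T x y z ≡ 0₃
Span (f ∷ fs) T = ∃[ g ] ∃[ T′ ] Span fs T′ × (∀ x y z → T x y z ≡ slice f g x y z +₃ T′ x y z)

-- Stands in for a linear subspace: over 𝔽₃ every scalar multiple is a repeated sum. `respects` is a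
-- field because tensors are compared pointwise.
record Additive (Q : Tensor V → Set) : Set where
  field
    respects : ∀ {S T} → (∀ x y z → T x y z ≡ S x y z) → Q S → Q T
    zero-closed : Q (λ _ _ _ → 0₃)
    +-closed : ∀ {S T} → Q S → Q T → Q (λ x y z → S x y z +₃ T x y z)

  sum-closed : (h : W → Tensor V) (ws : List W) → All (Q ∘ h) ws →
    Q (λ x y z → foldr (λ w → h w x y z +₃_) 0₃ ws)
  sum-closed h []       []       = zero-closed
  sum-closed h (w ∷ ws) (q ∷ qs) = +-closed q (sum-closed h ws qs)

open Additive

slice-zero : (f : Factor V) → ∀ x y z → slice f (λ _ _ → 0₃) x y z ≡ 0₃
slice-zero (1st , u) x y z = *-zeroʳ (u x)
slice-zero (2nd , u) x y z = *-zeroʳ (u y)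
slice-zero (3rd , u) x y z = *-zeroʳ (u z)

slice-collect : (f : Factor V) → ∀ g g′ x y z t t′ →
  (slice f g x y z +₃ t) +₃ (slice f g′ x y z +₃ t′) ≡
  slice f (λ v w → g v w +₃ g′ v w) x y z +₃ (t +₃ t′)
slice-collect (1st , u) g g′ x y z t t′ = collect-slices (u x) (g y z) t (g′ y z) t′
slice-collect (2nd , u) g g′ x y z t t′ = collect-slices (u y) (g z x) t (g′ z x) t′
slice-collect (3rd , u) g g′ x y z t t′ = collect-slices (u z) (g x y) t (g′ x y) t′

-- Two decompositions over the same factors add slice by slice, since corresponding slices share
-- their u.
span-additive : (fs : Vec (Factor V) r) → Additive (Span fs)
span-additive [] = record
  { respects    = λ T≗S S≗0 x y z → trans (T≗S x y z) (S≗0 x y z)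
  ; zero-closed = λ _ _ _ → refl
  ; +-closed    = λ S≗0 T≗0 x y z → cong₂ _+₃_ (S≗0 x y z) (T≗0 x y z)
  }
span-additive (f ∷ fs) = record
  { respects = λ { T≗S (g , S′ , S′∈ , eq) →
      g , S′ , S′∈ , λ x y z → trans (T≗S x y z) (eq x y z) }
  ; zero-closed = (λ _ _ → 0₃) , (λ _ _ _ → 0₃) , zero-closed (span-additive fs) ,
      λ x y z → sym (trans (+-identityʳ (slice f (λ _ _ → 0₃) x y z)) (slice-zero f x y z))
  ; +-closed    = λ { (g , S′ , S′∈ , eq) (g′ , T′ , T′∈ , eq′) →
      (λ v w → g v w +₃ g′ v w) , (λ x y z → S′ x y z +₃ T′ x y z) ,
      +-closed (span-additive fs) S′∈ T′∈ ,
      λ x y z → trans (cong₂ _+₃_ (eq x y z) (eq′ x y z))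
                      (slice-collect f g g′ x y z (S′ x y z) (T′ x y z)) }
  }

slice-∈-span : (fs : Vec (Factor V) r) {f : Factor V} → f Vec.∈ fs → ∀ g → Span fs (slice f g)
slice-∈-span (f ∷ fs) (VecAny.here refl) g =
  g , (λ _ _ _ → 0₃) , zero-closed (span-additive fs) , λ x y z → sym (+-identityʳ (slice f g x y z))
slice-∈-span (f ∷ fs) {f′} (VecAny.there f′∈fs) g =
  (λ _ _ → 0₃) , _ , slice-∈-span fs f′∈fs g ,
  λ x y z → sym (trans (cong (_+₃ slice f′ g x y z) (slice-zero f x y z)) (+-identityˡ (slice f′ g x y z)))

-- Pullback, rotation and elimination of slice decompositions.

pullback : (W → V) → Factor V → Factor W
pullback φ (a , u) = a , u ∘ φ

slice-pullback : (φ : W → V) (f : Factor V) → ∀ g x y z →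
  slice f g (φ x) (φ y) (φ z) ≡ slice (pullback φ f) (λ v w → g (φ v) (φ w)) x y z
slice-pullback φ (1st , u) g x y z = refl
slice-pullback φ (2nd , u) g x y z = refl
slice-pullback φ (3rd , u) g x y z = refl

span-pullback : (φ : W → V) (fs : Vec (Factor V) r) {T : Tensor V} → Span fs T →
  Span (Vec.map (pullback φ) fs) (λ x y z → T (φ x) (φ y) (φ z))
span-pullback φ []       T≗0 x y z = T≗0 (φ x) (φ y) (φ z)
span-pullback φ (f ∷ fs) (g , T′ , T′∈ , eq) =
  _ , _ , span-pullback φ fs T′∈ ,
  λ x y z → trans (eq (φ x) (φ y) (φ z)) (cong (_+₃ T′ (φ x) (φ y) (φ z)) (slice-pullback φ f g x y z))

rotate : Tensor V → Tensor V
rotate T x y z = T y z x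

rotateFactor : Factor V → Factor V
rotateFactor (1st , u) = 2nd , u
rotateFactor (2nd , u) = 3rd , u
rotateFactor (3rd , u) = 1st , u

slice-rotate : (f : Factor V) → ∀ g x y z →
  rotate (slice f g) x y z ≡ slice (rotateFactor f) g x y z
slice-rotate (1st , u) g x y z = refl
slice-rotate (2nd , u) g x y z = refl
slice-rotate (3rd , u) g x y z = refl

span-rotate : (fs : Vec (Factor V) r) {T : Tensor V} → Span fs T →
  Span (Vec.map rotateFactor fs) (rotate T)
span-rotate []       T≗0 x y z = T≗0 y z x
span-rotate (f ∷ fs) (g , T′ , T′∈ , eq) =
  g , rotate T′ , span-rotate fs T′∈ ,
  λ x y z → trans (eq y z x) (cong (_+₃ T′ y z x) (slice-rotate f g x y z))

-- Row operation of Gaussian elimination along the first axis, with pivot layer `p`.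
eliminate : (V → 𝔽₃) → V → Tensor V → Tensor V
eliminate c p T x y z = T x y z -₃ c x *₃ T p y z

eliminateFactor : (V → 𝔽₃) → V → Factor V → Factor V
eliminateFactor c p (1st , u) = 1st , λ x → u x -₃ c x *₃ u p
eliminateFactor c p (2nd , u) = 2nd , u
eliminateFactor c p (3rd , u) = 3rd , u

eliminate-1st : ∀ u g t c u′ t′ →
  (u *₃ g +₃ t) -₃ c *₃ (u′ *₃ g +₃ t′) ≡ (u -₃ c *₃ u′) *₃ g +₃ (t -₃ c *₃ t′)
eliminate-1st = from-yes (all? λ u → all? λ g → all? λ t → all? λ c → all? λ u′ → all? λ t′ →
  (u *₃ g +₃ t) -₃ c *₃ (u′ *₃ g +₃ t′) ≟ (u -₃ c *₃ u′) *₃ g +₃ (t -₃ c *₃ t′))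

eliminate-other : ∀ u g t c g′ t′ →
  (u *₃ g +₃ t) -₃ c *₃ (u *₃ g′ +₃ t′) ≡ u *₃ (g -₃ c *₃ g′) +₃ (t -₃ c *₃ t′)
eliminate-other = from-yes (all? λ u → all? λ g → all? λ t → all? λ c → all? λ g′ → all? λ t′ →
  (u *₃ g +₃ t) -₃ c *₃ (u *₃ g′ +₃ t′) ≟ u *₃ (g -₃ c *₃ g′) +₃ (t -₃ c *₃ t′))

-- Along the first axis the row operation acts on u and leaves g alone. Along the other axes u does
-- not depend on x, so it factors out and g absorbs the operation. Either way one slice stays one
-- slice.
slice-eliminate : (c : V → 𝔽₃) (p : V) (f : Factor V) → ∀ g T′ → ∃[ g′ ] ∀ x y z →
  eliminate c p (λ x y z → slice f g x y z +₃ T′ x y z) x y z ≡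
  slice (eliminateFactor c p f) g′ x y z +₃ eliminate c p T′ x y z
slice-eliminate c p (1st , u) g T′ = g ,
  λ x y z → eliminate-1st (u x) (g y z) (T′ x y z) (c x) (u p) (T′ p y z)
slice-eliminate c p (2nd , u) g T′ = (λ z x → g z x -₃ c x *₃ g z p) ,
  λ x y z → eliminate-other (u y) (g z x) (T′ x y z) (c x) (g z p) (T′ p y z)
slice-eliminate c p (3rd , u) g T′ = (λ x y → g x y -₃ c x *₃ g p y) ,
  λ x y z → eliminate-other (u z) (g x y) (T′ x y z) (c x) (g p y) (T′ p y z)

span-eliminate : ∀ c p (fs : Vec (Factor V) r) {T : Tensor V} → Span fs T →
  Span (Vec.map (eliminateFactor c p) fs) (eliminate c p T)
span-eliminate c p []       T≗0 x y z =
  cong₂ _-₃_ (T≗0 x y z) (trans (cong (c x *₃_) (T≗0 p y z)) (*-zeroʳ (c x)))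
span-eliminate c p (f ∷ fs) (g , T′ , T′∈ , eq) with slice-eliminate c p f g T′
... | g′ , eq′ = g′ , _ , span-eliminate c p fs T′∈ ,
  λ x y z → trans (cong₂ (λ s t → s -₃ c x *₃ t) (eq x y z) (eq p y z)) (eq′ x y z)

-- Diagonal tensors and the lower bound for their slice rank.

record Diagonal (T : Tensor V) : Set where
  field
    off-diagonal : ∀ {x y z} → T x y z ≢ 0₃ → x ≡ y × y ≡ z
    on-diagonal  : ∀ x → T x x x ≢ 0₃

open Diagonal

diagonal-resp : {S T : Tensor V} → (∀ x y z → T x y z ≡ S x y z) → Diagonal S → Diagonal T
diagonal-resp T≗S d = record
  { off-diagonal = λ {x} {y} {z} T≢0 → off-diagonal d (T≢0 ∘ trans (T≗S x y z))
  ; on-diagonal  = λ x → on-diagonal d x ∘ trans (sym (T≗S x x x))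
  }

diagonal-pullback : (φ : W → V) → (∀ {x y} → φ x ≡ φ y → x ≡ y) →
  {T : Tensor V} → Diagonal T → Diagonal (λ x y z → T (φ x) (φ y) (φ z))
diagonal-pullback φ φ-inj d = record
  { off-diagonal = λ T≢0 → let x≡y , y≡z = off-diagonal d T≢0 in φ-inj x≡y , φ-inj y≡z
  ; on-diagonal  = on-diagonal d ∘ φ
  }

diagonal-rotate : {T : Tensor V} → Diagonal T → Diagonal (rotate T)
diagonal-rotate d = record
  { off-diagonal = λ T≢0 → let y≡z , z≡x = off-diagonal d T≢0 in trans (sym z≡x) (sym y≡z) , y≡z
  ; on-diagonal  = on-diagonal d
  }

-- The pivot is its own inverse in 𝔽₃, so c = u p · u x clears the factor u.
clear-pivot : ∀ u u′ g t t′ → u′ ≢ 0₃ →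
  (u *₃ g +₃ t) -₃ (u′ *₃ u) *₃ (u′ *₃ g +₃ t′) ≡ t -₃ (u′ *₃ u) *₃ t′
clear-pivot = from-yes (all? λ u → all? λ u′ → all? λ g → all? λ t → all? λ t′ →
  ¬? (u′ ≟ 0₃) →-dec
  ((u *₃ g +₃ t) -₃ (u′ *₃ u) *₃ (u′ *₃ g +₃ t′) ≟ t -₃ (u′ *₃ u) *₃ t′))

-- `N` is quantified inside so that the induction on `r` may pass to a smaller index set.
SliceRankBound : ℕ → Set
SliceRankBound r = ∀ {N} (fs : Vec (Factor (Fin N)) r) {T} → Span fs T → Diagonal T → N ℕ.≤ r

-- Removing the pivot p from the index set turns T into a diagonal tensor on
-- one point less, unchanged by the elimination since T p y z = 0 for y ≠ p.
slice-rank-1st : SliceRankBound r → ∀ {N} (u : Fin N → 𝔽₃) (fs : Vec (Factor (Fin N)) r) {T} →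
  Span ((1st , u) ∷ fs) T → Diagonal T → N ℕ.≤ suc r
slice-rank-1st {r} ih {N} u fs {T} (g , T′ , T′∈ , eq) d with any? (λ x → ¬? (u x ≟ 0₃))
-- If u vanishes everywhere, its slice contributes nothing and the remaining factors span T on the
-- same index set.
... | no u≡0 = ℕ.m≤n⇒m≤1+n (ih fs T′∈ (diagonal-resp T′≗T d))
  where
  T′≗T : ∀ x y z → T′ x y z ≡ T x y z
  T′≗T x y z = sym (trans (eq x y z) (trans
    (cong (λ a → a *₃ g y z +₃ T′ x y z) (decidable-stable (u x ≟ 0₃) λ ux≢0 → u≡0 (x , ux≢0)))
    (+-identityˡ (T′ x y z))))
slice-rank-1st {r} ih {suc N} u fs {T} (g , T′ , T′∈ , eq) d | yes (p , up≢0) =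
  s≤s (ih _ (span-pullback φ _ (span-eliminate c p fs T′∈))
    (diagonal-resp restricted (diagonal-pullback φ (punchIn-injective p _ _) d)))
  where
  φ = punchIn p
  c : Fin (suc N) → 𝔽₃
  c x = u p *₃ u x

  T-p : ∀ y z → T p (φ y) z ≡ 0₃
  T-p y z = decidable-stable (T p (φ y) z ≟ 0₃)
    λ T≢0 → punchInᵢ≢i p y (sym (proj₁ (off-diagonal d T≢0)))

  restricted : ∀ x y z → eliminate c p T′ (φ x) (φ y) (φ z) ≡ T (φ x) (φ y) (φ z)
  restricted x y z = begin
    eliminate c p T′ (φ x) (φ y) (φ z)
      ≡⟨ clear-pivot (u (φ x)) (u p) _ _ _ up≢0 ⟨
    (u (φ x) *₃ g (φ y) (φ z) +₃ T′ (φ x) (φ y) (φ z)) -₃ c (φ x) *₃ (u p *₃ g (φ y) (φ z) +₃ T′ p (φ y) (φ z))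
      ≡⟨ cong₂ (λ s t → s -₃ c (φ x) *₃ t) (eq (φ x) (φ y) (φ z)) (eq p (φ y) (φ z)) ⟨
    T (φ x) (φ y) (φ z) -₃ c (φ x) *₃ T p (φ y) (φ z)
      ≡⟨ cong (λ t → T (φ x) (φ y) (φ z) -₃ t) (trans (cong (c (φ x) *₃_) (T-p y (φ z))) (*-zeroʳ (c (φ x)))) ⟩
    T (φ x) (φ y) (φ z) -₃ 0₃
      ≡⟨ +-identityʳ _ ⟩
    T (φ x) (φ y) (φ z) ∎
    where open ≡-Reasoning

-- Induction on `r`: the head factor is turned onto the first axis, where eliminating it costs at
-- most one point. With no factors the tensor is zero, which contradicts a nonzero diagonal entry.
slice-rank : ∀ r → SliceRankBound r
slice-rank zero    {zero}  []               T≗0 d = z≤n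
slice-rank zero    {suc N} []               T≗0 d = contradiction (T≗0 zero zero zero) (on-diagonal d zero)
slice-rank (suc r) ((1st , u) ∷ fs) T∈ d = slice-rank-1st (slice-rank r) u fs T∈ d
-- One rotation takes the second axis to the third, another takes the third to the first.
slice-rank (suc r) ((2nd , u) ∷ fs) T∈ d =
  slice-rank-1st (slice-rank r) u _
    (span-rotate ((3rd , u) ∷ Vec.map rotateFactor fs) (span-rotate ((2nd , u) ∷ fs) T∈)) (diagonal-rotate (diagonal-rotate d))
slice-rank (suc r) ((3rd , u) ∷ fs) T∈ d =
  slice-rank-1st (slice-rank r) u _ (span-rotate ((3rd , u) ∷ fs) T∈) (diagonal-rotate d)

-- The tensor δ as a polynomial of degree 2n.

power : Fin 3 → 𝔽₃ → 𝔽₃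
power zero             x = 1₃
power (suc zero)       x = x
power (suc (suc zero)) x = x *₃ x

Exponent : ℕ → Set
Exponent n = Vec (Fin 3) n

degree : Exponent n → ℕ
degree []      = 0
degree (i ∷ a) = toℕ i ℕ.+ degree a

mono : Exponent n → 𝔽₃^ n → 𝔽₃
mono []      []       = 1₃
mono (i ∷ a) (x ∷ xs) = power i x *₃ mono a xs

monomial : (a b c : Exponent n) → Tensor (𝔽₃^ n)
monomial a b c x y z = mono a x *₃ (mono b y *₃ mono c z)

-- Nonzero squares in 𝔽₃ equal 1, so the value is 1 when x + y + z = 0 and 0 otherwise.
δ₁ : Tensor 𝔽₃
δ₁ x y z = 1₃ -₃ (x +₃ y +₃ z) *₃ (x +₃ y +₃ z)

δ : Tensor (𝔽₃^ n)
δ []       []       []       = 1₃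
δ (x ∷ xs) (y ∷ ys) (z ∷ zs) = δ₁ x y z *₃ δ xs ys zs

Term : Set
Term = Fin 3 × Fin 3 × Fin 3

term : Term → Tensor 𝔽₃
term (i , j , k) x y z = power i x *₃ (power j y *₃ power k z)

-- 1 - (x + y + z)² = 1 + 2x² + 2y² + 2z² + xy + yz + xz over 𝔽₃; the
-- coefficients 2 appear as repetitions.
terms : List Term
terms =
  (0₃ , 0₃ , 0₃) ∷
  (2₃ , 0₃ , 0₃) ∷ (2₃ , 0₃ , 0₃) ∷
  (0₃ , 2₃ , 0₃) ∷ (0₃ , 2₃ , 0₃) ∷
  (0₃ , 0₃ , 2₃) ∷ (0₃ , 0₃ , 2₃) ∷
  (1₃ , 1₃ , 0₃) ∷ (0₃ , 1₃ , 1₃) ∷ (1₃ , 0₃ , 1₃) ∷ []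

termDegree : Term → ℕ
termDegree (i , j , k) = toℕ i ℕ.+ (toℕ j ℕ.+ toℕ k)

terms-degree : All (λ t → termDegree t ℕ.≤ 2) terms
terms-degree = from-yes (All.all? (λ t → termDegree t ℕ.≤? 2) terms)

-- `d` stands for the value of `δ` on the remaining coordinates; with it included, the finite check
-- also distributes the product over the sum.
δ₁-expansion : ∀ x y z d →
  δ₁ x y z *₃ d ≡ foldr (λ t → term t x y z *₃ d +₃_) 0₃ terms
δ₁-expansion = from-yes (all? λ x → all? λ y → all? λ z → all? λ d →
  δ₁ x y z *₃ d ≟ foldr (λ t → term t x y z *₃ d +₃_) 0₃ terms)

monomial-∷ : ∀ i j k (a b c : Exponent n) x y z xs ys zs →
  monomial (i ∷ a) (j ∷ b) (k ∷ c) (x ∷ xs) (y ∷ ys) (z ∷ zs) ≡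
  term (i , j , k) x y z *₃ monomial a b c xs ys zs
monomial-∷ i j k a b c x y z xs ys zs = trans
  (cong (power i x *₃ mono a xs *₃_) (*-interchange (power j y) (mono b ys) (power k z) (mono c zs)))
  (*-interchange (power i x) (mono a xs) (power j y *₃ power k z) (mono b ys *₃ mono c zs))

mulTerm : Term → Tensor (𝔽₃^ n) → Tensor (𝔽₃^ (suc n))
mulTerm t T (x ∷ xs) (y ∷ ys) (z ∷ zs) = term t x y z *₃ T xs ys zs

-- Multiplication by a term is linear, so additivity pulls back along it.
mulTerm-additive : ∀ t {Q : Tensor (𝔽₃^ (suc n)) → Set} → Additive Q → Additive (Q ∘ mulTerm t)
mulTerm-additive t Q⁺ = record
  { respects    = λ T≗S → respects Q⁺
      λ { (x ∷ xs) (y ∷ ys) (z ∷ zs) → cong (term t x y z *₃_) (T≗S xs ys zs) }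
  ; zero-closed = respects Q⁺
      (λ { (x ∷ _) (y ∷ _) (z ∷ _) → *-zeroʳ (term t x y z) }) (zero-closed Q⁺)
  ; +-closed    = λ {S} {T} S∈ T∈ → respects Q⁺
      (λ { (x ∷ xs) (y ∷ ys) (z ∷ zs) → *-distribˡ-+ (term t x y z) (S xs ys zs) (T xs ys zs) })
      (+-closed Q⁺ S∈ T∈)
  }

degree-∷ : ∀ i j k a b c n → i ℕ.+ (j ℕ.+ k) ℕ.≤ 2 → a ℕ.+ (b ℕ.+ c) ℕ.≤ 2 ℕ.* n →
  (i ℕ.+ a) ℕ.+ ((j ℕ.+ b) ℕ.+ (k ℕ.+ c)) ℕ.≤ 2 ℕ.* suc n
degree-∷ i j k a b c n ijk≤2 abc≤2n = begin
  (i ℕ.+ a) ℕ.+ ((j ℕ.+ b) ℕ.+ (k ℕ.+ c))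
    ≡⟨ solve 6 (λ i j k a b c → (i :+ a) :+ ((j :+ b) :+ (k :+ c)) :=
                                (i :+ (j :+ k)) :+ (a :+ (b :+ c))) refl i j k a b c ⟩
  (i ℕ.+ (j ℕ.+ k)) ℕ.+ (a ℕ.+ (b ℕ.+ c))
    ≤⟨ ℕ.+-mono-≤ ijk≤2 abc≤2n ⟩
  2 ℕ.+ 2 ℕ.* n
    ≡⟨ ℕ.*-suc 2 n ⟨
  2 ℕ.* suc n ∎
  where
  open ℕ.≤-Reasoning
  open ℕ-Solver.+-*-Solver

-- δ is a sum of monomials of degree at most 2n; the sum itself is never named.
δ-induction : ∀ n {Q : Tensor (𝔽₃^ n) → Set} → Additive Q →
  (∀ a b c → degree a ℕ.+ (degree b ℕ.+ degree c) ℕ.≤ 2 ℕ.* n → Q (monomial a b c)) → Q δ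
δ-induction zero    Q⁺ Q-monomial =
  respects Q⁺ (λ { [] [] [] → refl }) (Q-monomial [] [] [] z≤n)
δ-induction (suc n) {Q} Q⁺ Q-monomial =
  respects Q⁺ expansion (sum-closed Q⁺ (λ t → mulTerm t δ) terms (All.map step terms-degree))
  where
  expansion : ∀ x y z → δ x y z ≡ foldr (λ t → mulTerm t δ x y z +₃_) 0₃ terms
  expansion (x ∷ xs) (y ∷ ys) (z ∷ zs) = δ₁-expansion x y z (δ xs ys zs)

  step : ∀ {t} → termDegree t ℕ.≤ 2 → Q (mulTerm t δ)
  -- The induction hypothesis is applied to the predicate `Q ∘ mulTerm t`, which trades the first
  -- coordinate for the term `t`.
  step {t@(i , j , k)} t≤2 = δ-induction n (mulTerm-additive t Q⁺) λ a b c abc≤2n → respects Q⁺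
    (λ { (x ∷ xs) (y ∷ ys) (z ∷ zs) → sym (monomial-∷ i j k a b c x y z xs ys zs) })
    (Q-monomial (i ∷ a) (j ∷ b) (k ∷ c)
      (degree-∷ (toℕ i) (toℕ j) (toℕ k) (degree a) (degree b) (degree c) n t≤2 abc≤2n))

-- Low-degree exponents and the slice decomposition of δ.

exponents : ∀ n → List (Exponent n)
exponents zero    = [] ∷ []
exponents (suc n) = cartesianProductWith _∷_ (allFin 3) (exponents n)

∈-exponents : (a : Exponent n) → a ∈ exponents n
∈-exponents []      = here refl
∈-exponents (i ∷ a) = ∈-cartesianProductWith⁺ _∷_ (∈-allFin i) (∈-exponents a)

Low : Exponent n → Set
Low {n} a = 3 ℕ.* degree a ℕ.≤ 2 ℕ.* n

low? : (a : Exponent n) → Dec (Low a)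
low? {n} a = 3 ℕ.* degree a ℕ.≤? 2 ℕ.* n

lowExponents : ∀ n → List (Exponent n)
lowExponents n = filter low? (exponents n)

axes : List Axis
axes = 1st ∷ 2nd ∷ 3rd ∷ []

lowFactors : ∀ n → List (Factor (𝔽₃^ n))
lowFactors n = cartesianProduct axes (map mono (lowExponents n))

low-factor : ∀ {s} (a : Exponent n) → s ∈ axes → Low a → (s , mono a) ∈ lowFactors n
low-factor a s∈ a-low =
  ∈-cartesianProduct⁺ s∈ (∈-map⁺ mono (∈-filter⁺ low? (∈-exponents a) a-low))

-- If all three failed, adding the strict inequalities would give 3m < 3(a + b + c).
some-third-of-sum-≤ : ∀ a b c {m} → a ℕ.+ (b ℕ.+ c) ℕ.≤ m →
  3 ℕ.* a ℕ.≤ m ⊎ 3 ℕ.* b ℕ.≤ m ⊎ 3 ℕ.* c ℕ.≤ m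
some-third-of-sum-≤ a b c {m} abc≤m with 3 ℕ.* a ℕ.≤? m | 3 ℕ.* b ℕ.≤? m | 3 ℕ.* c ℕ.≤? m
... | yes 3a≤m | _        | _        = inj₁ 3a≤m
... | no _     | yes 3b≤m | _        = inj₂ (inj₁ 3b≤m)
... | no _     | no _     | yes 3c≤m = inj₂ (inj₂ 3c≤m)
... | no 3a≰m  | no 3b≰m  | no 3c≰m  = contradiction (ℕ.*-monoʳ-≤ 3 abc≤m) (ℕ.<⇒≱ (begin-strict
  3 ℕ.* m
    ≡⟨ solve 1 (λ m → con 3 :* m := m :+ (m :+ m)) refl m ⟩
  m ℕ.+ (m ℕ.+ m)
    <⟨ ℕ.+-mono-< (ℕ.≰⇒> 3a≰m) (ℕ.+-mono-< (ℕ.≰⇒> 3b≰m) (ℕ.≰⇒> 3c≰m)) ⟩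
  3 ℕ.* a ℕ.+ (3 ℕ.* b ℕ.+ 3 ℕ.* c)
    ≡⟨ solve 3 (λ a b c → con 3 :* a :+ (con 3 :* b :+ con 3 :* c) := con 3 :* (a :+ (b :+ c))) refl a b c ⟩
  3 ℕ.* (a ℕ.+ (b ℕ.+ c)) ∎))
  where
  open ℕ.≤-Reasoning
  open ℕ-Solver.+-*-Solver

-- In each monomial one of the three factors has a low exponent; it becomes the u of a slice, and
-- the product of the other two becomes g.
δ-span : ∀ n → Span (fromList (lowFactors n)) (δ {n})
δ-span n = δ-induction n fs⁺ monomial-∈
  where
  fs = fromList (lowFactors n)
  fs⁺ = span-additive fs

  monomial-∈ : ∀ a b c → degree a ℕ.+ (degree b ℕ.+ degree c) ℕ.≤ 2 ℕ.* n → Span fs (monomial a b c)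
  monomial-∈ a b c abc≤2n with some-third-of-sum-≤ (degree a) (degree b) (degree c) abc≤2n
  ... | inj₁ a-low = slice-∈-span fs (∈-fromList⁺ (low-factor a (here refl) a-low))
    λ y z → mono b y *₃ mono c z
  -- Rotating the product puts the low factor first and leaves the other two in the cyclic order
  -- that `slice` expects.
  ... | inj₂ (inj₁ b-low) = respects fs⁺
    (λ x y z → *-rotate (mono a x) (mono b y) (mono c z))
    (slice-∈-span fs (∈-fromList⁺ (low-factor b (there (here refl)) b-low))
      λ z x → mono c z *₃ mono a x)
  ... | inj₂ (inj₂ c-low) = respects fs⁺
    (λ x y z → trans (*-rotate (mono a x) (mono b y) (mono c z)) (*-rotate (mono b y) (mono c z) (mono a x)))
    (slice-∈-span fs (∈-fromList⁺ (low-factor c (there (there (here refl))) c-low))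
      λ x y → mono a x *₃ mono b y)

-- The restriction of δ to a cap.

-- This is -x - y, written as x + 2(y - x) so that it is by definition the point with parameter 2 on
-- the line through x and y.
third : 𝔽₃^ n → 𝔽₃^ n → 𝔽₃^ n
third x y = x ⊕ 2₃ · (y ⊕ 2₃ · x)

δ₁-third : ∀ x y z → δ₁ x y z ≢ 0₃ → z ≡ x +₃ 2₃ *₃ (y +₃ 2₃ *₃ x)
δ₁-third = from-yes (all? λ x → all? λ y → all? λ z →
  ¬? (δ₁ x y z ≟ 0₃) →-dec (z ≟ x +₃ 2₃ *₃ (y +₃ 2₃ *₃ x)))

δ-third : (x y z : 𝔽₃^ n) → δ x y z ≢ 0₃ → z ≡ third x y
δ-third []       []       []       _   = refl
δ-third (x ∷ xs) (y ∷ ys) (z ∷ zs) δ≢0 with nonzero-product (δ₁ x y z) (δ xs ys zs) δ≢0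
... | δ₁≢0 , δ′≢0 = cong₂ _∷_ (δ₁-third x y z δ₁≢0) (δ-third xs ys zs δ′≢0)

δ₁-rotate : ∀ x y z → δ₁ x y z ≡ δ₁ y z x
δ₁-rotate = from-yes (all? λ x → all? λ y → all? λ z → δ₁ x y z ≟ δ₁ y z x)

δ-rotate : (x y z : 𝔽₃^ n) → δ x y z ≡ δ y z x
δ-rotate []       []       []       = refl
δ-rotate (x ∷ xs) (y ∷ ys) (z ∷ zs) = cong₂ _*₃_ (δ₁-rotate x y z) (δ-rotate xs ys zs)

δ₁-diagonal : ∀ x → δ₁ x x x ≡ 1₃
δ₁-diagonal = from-yes (all? λ x → δ₁ x x x ≟ 1₃)

δ-diagonal : (x : 𝔽₃^ n) → δ x x x ≡ 1₃
δ-diagonal []       = refl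
δ-diagonal (x ∷ xs) = cong₂ _*₃_ (δ₁-diagonal x) (δ-diagonal xs)

third₁-idem : ∀ x → x +₃ 2₃ *₃ (x +₃ 2₃ *₃ x) ≡ x
third₁-idem = from-yes (all? λ x → x +₃ 2₃ *₃ (x +₃ 2₃ *₃ x) ≟ x)

third-idem : (x : 𝔽₃^ n) → third x x ≡ x
third-idem []       = refl
third-idem (x ∷ xs) = cong₂ _∷_ (third₁-idem x) (third-idem xs)

0·-line : (x d : 𝔽₃^ n) → x ≡ x ⊕ 0₃ · d
0·-line []       []      = refl
0·-line (x ∷ xs) (_ ∷ d) = cong₂ _∷_ (sym (+-identityʳ x)) (0·-line xs d)

difference₁ : ∀ x y → y ≡ x +₃ 1₃ *₃ (y +₃ 2₃ *₃ x)
difference₁ = from-yes (all? λ x → all? λ y → y ≟ x +₃ 1₃ *₃ (y +₃ 2₃ *₃ x))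

1·-line : (x y : 𝔽₃^ n) → y ≡ x ⊕ 1₃ · (y ⊕ 2₃ · x)
1·-line []       []       = refl
1·-line (x ∷ xs) (y ∷ ys) = cong₂ _∷_ (difference₁ x y) (1·-line xs ys)

difference₁-zero : ∀ x y → y +₃ 2₃ *₃ x ≡ 0₃ → x ≡ y
difference₁-zero = from-yes (all? λ x → all? λ y → (y +₃ 2₃ *₃ x ≟ 0₃) →-dec (x ≟ y))

difference-zero : (x y : 𝔽₃^ n) → y ⊕ 2₃ · x ≡ 𝟎 → x ≡ y
difference-zero []       []       _  = refl
difference-zero (x ∷ xs) (y ∷ ys) eq =
  cong₂ _∷_ (difference₁-zero x y (cong head eq)) (difference-zero xs ys (cong tail eq))

third-collinear : (x y : 𝔽₃^ n) → x ≢ y → Collinear x y (third x y)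
third-collinear x y x≢y =
  x , y ⊕ 2₃ · x , x≢y ∘ difference-zero x y ,
  (0₃ , 0·-line x _) , (1₃ , 1·-line x y) , (2₃ , refl)

-- In characteristic 3, 2x + z = 0 means z = x.
third-of-equal : {x y z : 𝔽₃^ n} → δ x y z ≢ 0₃ → x ≡ y → z ≡ x
third-of-equal {x = x} {z = z} δ≢0 refl = trans (δ-third x x z δ≢0) (third-idem x)

-- If two arguments agree, the cyclic symmetry of δ brings them to the front and the third agrees
-- too. Three distinct arguments would be collinear, z being the third point on the line through x
-- and y.
cap-off-diagonal : (A : FiniteSubset (𝔽₃^ n)) → AffineCap A → ∀ {x y z} →
  x ∈ elements A → y ∈ elements A → z ∈ elements A → δ x y z ≢ 0₃ → x ≡ y × y ≡ z
cap-off-diagonal A cap {x} {y} {z} x∈ y∈ z∈ δ≢0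
  with ≡-dec _≟_ x y | ≡-dec _≟_ x z | ≡-dec _≟_ y z
... | yes x≡y | _       | _       = x≡y , trans (sym x≡y) (sym (third-of-equal δ≢0 x≡y))
... | no _    | yes x≡z | _       = sym y≡x′ , trans y≡x′ x≡z
  where
  y≡x′ : y ≡ x
  y≡x′ = trans (third-of-equal (δ≢0 ∘ trans (trans (δ-rotate x y z) (δ-rotate y z x))) (sym x≡z)) (sym x≡z)
... | no _    | no _    | yes y≡z = third-of-equal (δ≢0 ∘ trans (δ-rotate x y z)) y≡z , y≡z
... | no x≢y  | no x≢z  | no y≢z  = contradiction
  (subst (Collinear x y) (sym (δ-third x y z δ≢0)) (third-collinear x y x≢y))
  (cap x∈ y∈ z∈ x≢y x≢z y≢z)

lookup-injective : {xs : List V} → Unique xs → ∀ {i j} → List.lookup xs i ≡ List.lookup xs j → i ≡ j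
lookup-injective (x∉xs ∷ xs!) {zero}  {zero}  eq = refl
lookup-injective (x∉xs ∷ xs!) {zero}  {suc j} eq = contradiction eq (All.lookup x∉xs (∈-lookup j))
lookup-injective (x∉xs ∷ xs!) {suc i} {zero}  eq = contradiction (sym eq) (All.lookup x∉xs (∈-lookup i))
lookup-injective (x∉xs ∷ xs!) {suc i} {suc j} eq = cong suc (lookup-injective xs! eq)

-- Points of the cap are indexed by list positions to give the index set `Fin ∣ A ∣` of
-- `slice-rank`; the absence of duplicates turns equal points into equal positions.
cap-diagonal : (A : FiniteSubset (𝔽₃^ n)) → AffineCap A →
  let φ = List.lookup (elements A) in Diagonal (λ i j k → δ (φ i) (φ j) (φ k))
cap-diagonal A cap = record
  { off-diagonal = λ δ≢0 →
      let x≡y , y≡z = cap-off-diagonal A cap (∈-lookup _) (∈-lookup _) (∈-lookup _) δ≢0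
      in lookup-injective (unique A) x≡y , lookup-injective (unique A) y≡z
  ; on-diagonal = λ i δ≡0 → contradiction (trans (sym (δ-diagonal (List.lookup (elements A) i))) δ≡0) λ ()
  }

length-cartesianProduct : (vs : List V) (ws : List W) →
  length (cartesianProduct vs ws) ≡ length vs ℕ.* length ws
length-cartesianProduct []       ws = refl
length-cartesianProduct (v ∷ vs) ws = trans (length-++ (map (v ,_) ws))
  (cong₂ ℕ._+_ (length-map (v ,_) ws) (length-cartesianProduct vs ws))

cap-bound : (A : FiniteSubset (𝔽₃^ n)) → AffineCap A → ∣ A ∣ ℕ.≤ 3 ℕ.* length (lowExponents n)
cap-bound {n} A cap = subst (∣ A ∣ ℕ.≤_)
  (trans (length-cartesianProduct axes (map mono (lowExponents n)))
         (cong (3 ℕ.*_) (length-map mono (lowExponents n))))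
  (slice-rank _ _ (span-pullback (List.lookup (elements A)) _ (δ-span n)) (cap-diagonal A cap))

-- Counting the low exponents by weights.

-- 10000 t^(2 - 3i) for t = 5/4, the factor 10000 clearing the denominators.
-- The optimal t is about 1.19; t = 5/4 already gives 2.7721 < 2.84.
weight₁ : Fin 3 → ℕ
weight₁ zero             = 15625
weight₁ (suc zero)       = 8000
weight₁ (suc (suc zero)) = 4096

weight : Exponent n → ℕ
weight []      = 1
weight (i ∷ a) = weight₁ i ℕ.* weight a

sum-*ˡ : (k : ℕ) (f : V → ℕ) (xs : List V) → sum (map (λ x → k ℕ.* f x) xs) ≡ k ℕ.* sum (map f xs)
sum-*ˡ k f []       = sym (ℕ.*-zeroʳ k)
sum-*ˡ k f (x ∷ xs) = trans (cong (k ℕ.* f x ℕ.+_) (sum-*ˡ k f xs)) (sym (ℕ.*-distribˡ-+ k (f x) _))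

sum-weight-product : (is : List (Fin 3)) (as : List (Exponent n)) →
  sum (map weight (cartesianProductWith _∷_ is as)) ≡ sum (map weight₁ is) ℕ.* sum (map weight as)
sum-weight-product []       as = refl
sum-weight-product (i ∷ is) as = begin
  sum (map weight (map (i ∷_) as ++ rest))
    ≡⟨ cong sum (map-++ weight (map (i ∷_) as) rest) ⟩
  sum (map weight (map (i ∷_) as) ++ map weight rest)
    ≡⟨ sum-++ (map weight (map (i ∷_) as)) (map weight rest) ⟩
  sum (map weight (map (i ∷_) as)) ℕ.+ sum (map weight rest)
    ≡⟨ cong₂ ℕ._+_
         (trans (cong sum (sym (map-∘ as))) (sum-*ˡ (weight₁ i) weight as))
         (sum-weight-product is as) ⟩
  weight₁ i ℕ.* total ℕ.+ sum (map weight₁ is) ℕ.* total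
    ≡⟨ ℕ.*-distribʳ-+ total (weight₁ i) (sum (map weight₁ is)) ⟨
  (weight₁ i ℕ.+ sum (map weight₁ is)) ℕ.* total ∎
  where
  open ≡-Reasoning
  rest = cartesianProductWith _∷_ is as
  total = sum (map weight as)

-- 27721 = 15625 + 8000 + 4096 is the total weight of one coordinate, and the sum over all exponents
-- factors by coordinates.
sum-weight : ∀ n → sum (map weight (exponents n)) ≡ 27721 ℕ.^ n
sum-weight zero    = refl
sum-weight (suc n) = trans (sum-weight-product (allFin 3) (exponents n)) (cong (27721 ℕ.*_) (sum-weight n))

-- weight a = 10000ⁿ (5/4)^(2n - 3 degree a), in subtraction-free form.
weight-degree : (a : Exponent n) →
  weight a ℕ.* (125 ℕ.^ degree a ℕ.* 16 ℕ.^ n) ≡ 10000 ℕ.^ n ℕ.* (64 ℕ.^ degree a ℕ.* 25 ℕ.^ n)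
weight-degree []      = refl
weight-degree {suc n} (i ∷ a) = begin
  weight₁ i ℕ.* weight a ℕ.* (125 ℕ.^ (toℕ i ℕ.+ degree a) ℕ.* (16 ℕ.* 16 ℕ.^ n))
    ≡⟨ cong (λ p → weight₁ i ℕ.* weight a ℕ.* (p ℕ.* (16 ℕ.* 16 ℕ.^ n))) (ℕ.^-distribˡ-+-* 125 (toℕ i) (degree a)) ⟩
  weight₁ i ℕ.* weight a ℕ.* (125 ℕ.^ toℕ i ℕ.* 125 ℕ.^ degree a ℕ.* (16 ℕ.* 16 ℕ.^ n))
    ≡⟨ interchange (weight₁ i) (weight a) (125 ℕ.^ toℕ i) (125 ℕ.^ degree a) 16 (16 ℕ.^ n) ⟩
  weight₁ i ℕ.* (125 ℕ.^ toℕ i ℕ.* 16) ℕ.* (weight a ℕ.* (125 ℕ.^ degree a ℕ.* 16 ℕ.^ n))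
    ≡⟨ cong₂ ℕ._*_ (coordinate i) (weight-degree a) ⟩
  10000 ℕ.* (64 ℕ.^ toℕ i ℕ.* 25) ℕ.* (10000 ℕ.^ n ℕ.* (64 ℕ.^ degree a ℕ.* 25 ℕ.^ n))
    ≡⟨ interchange 10000 (10000 ℕ.^ n) (64 ℕ.^ toℕ i) (64 ℕ.^ degree a) 25 (25 ℕ.^ n) ⟨
  10000 ℕ.* 10000 ℕ.^ n ℕ.* (64 ℕ.^ toℕ i ℕ.* 64 ℕ.^ degree a ℕ.* (25 ℕ.* 25 ℕ.^ n))
    ≡⟨ cong (λ p → 10000 ℕ.^ suc n ℕ.* (p ℕ.* 25 ℕ.^ suc n)) (ℕ.^-distribˡ-+-* 64 (toℕ i) (degree a)) ⟨
  10000 ℕ.^ suc n ℕ.* (64 ℕ.^ (toℕ i ℕ.+ degree a) ℕ.* 25 ℕ.^ suc n) ∎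
  where
  open ≡-Reasoning
  open ℕ-Solver.+-*-Solver

  -- In one coordinate, (5/4)^(2 - 3i) = (25/16) (64/125)^i.
  coordinate : ∀ i → weight₁ i ℕ.* (125 ℕ.^ toℕ i ℕ.* 16) ≡ 10000 ℕ.* (64 ℕ.^ toℕ i ℕ.* 25)
  coordinate = from-yes (all? λ i →
    weight₁ i ℕ.* (125 ℕ.^ toℕ i ℕ.* 16) ℕ.≟ 10000 ℕ.* (64 ℕ.^ toℕ i ℕ.* 25))

  interchange : ∀ p p′ q q′ r r′ →
    p ℕ.* p′ ℕ.* (q ℕ.* q′ ℕ.* (r ℕ.* r′)) ≡ p ℕ.* (q ℕ.* r) ℕ.* (p′ ℕ.* (q′ ℕ.* r′))
  interchange = solve 6 (λ p p′ q q′ r r′ →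
    p :* p′ :* (q :* q′ :* (r :* r′)) := p :* (q :* r) :* (p′ :* (q′ :* r′))) refl

-- For s the degree and m = 2n - 3s, this turns 25ⁿ into 125ˢ 5ᵐ and 16ⁿ into 64ˢ 4ᵐ.
power-split : ∀ b s m n → 3 ℕ.* s ℕ.+ m ≡ 2 ℕ.* n → (b ℕ.^ 2) ℕ.^ n ≡ (b ℕ.^ 3) ℕ.^ s ℕ.* b ℕ.^ m
power-split b s m n eq = begin
  (b ℕ.^ 2) ℕ.^ n              ≡⟨ ℕ.^-*-assoc b 2 n ⟩
  b ℕ.^ (2 ℕ.* n)              ≡⟨ cong (b ℕ.^_) eq ⟨
  b ℕ.^ (3 ℕ.* s ℕ.+ m)        ≡⟨ ℕ.^-distribˡ-+-* b (3 ℕ.* s) m ⟩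
  b ℕ.^ (3 ℕ.* s) ℕ.* b ℕ.^ m  ≡⟨ cong (ℕ._* b ℕ.^ m) (ℕ.^-*-assoc b 3 s) ⟨
  (b ℕ.^ 3) ℕ.^ s ℕ.* b ℕ.^ m  ∎
  where open ≡-Reasoning

-- After `power-split` both sides share the factors 125ˢ and 64ˢ, and what remains is 4ᵐ ≤ 5ᵐ.
-- Lowness makes the truncated subtraction defining `m` exact.
low-weight : (a : Exponent n) → Low a → 10000 ℕ.^ n ℕ.≤ weight a
low-weight {n} a a-low = ℕ.*-cancelʳ-≤ (10000 ℕ.^ n) (weight a) scale (begin
  10000 ℕ.^ n ℕ.* scale
    ≤⟨ ℕ.*-monoʳ-≤ (10000 ℕ.^ n) (ℕ.*-monoʳ-≤ (125 ℕ.^ s) (ℕ.*-monoʳ-≤ (64 ℕ.^ s) (ℕ.^-monoˡ-≤ m (ℕ.n≤1+n 4)))) ⟩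
  10000 ℕ.^ n ℕ.* (125 ℕ.^ s ℕ.* (64 ℕ.^ s ℕ.* 5 ℕ.^ m))
    ≡⟨ cong (10000 ℕ.^ n ℕ.*_) (solve 3 (λ p q r → p :* (q :* r) := q :* (p :* r)) refl (125 ℕ.^ s) (64 ℕ.^ s) (5 ℕ.^ m)) ⟩
  10000 ℕ.^ n ℕ.* (64 ℕ.^ s ℕ.* (125 ℕ.^ s ℕ.* 5 ℕ.^ m))
    ≡⟨ cong (λ p → 10000 ℕ.^ n ℕ.* (64 ℕ.^ s ℕ.* p)) (power-split 5 s m n split) ⟨
  10000 ℕ.^ n ℕ.* (64 ℕ.^ s ℕ.* 25 ℕ.^ n)
    ≡⟨ weight-degree a ⟨
  weight a ℕ.* (125 ℕ.^ s ℕ.* 16 ℕ.^ n)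
    ≡⟨ cong (λ p → weight a ℕ.* (125 ℕ.^ s ℕ.* p)) (power-split 4 s m n split) ⟩
  weight a ℕ.* scale ∎)
  where
  open ℕ.≤-Reasoning
  open ℕ-Solver.+-*-Solver using (solve; _:*_; _:=_)
  s = degree a
  m = 2 ℕ.* n ℕ.∸ 3 ℕ.* s
  scale = 125 ℕ.^ s ℕ.* (64 ℕ.^ s ℕ.* 4 ℕ.^ m)

  split : 3 ℕ.* s ℕ.+ m ≡ 2 ℕ.* n
  split = ℕ.m+[n∸m]≡n a-low

  instance
    scale≢0 : NonZero scale
    scale≢0 = ℕ.m*n≢0 (125 ℕ.^ s) _ {{ℕ.m^n≢0 125 s}} {{ℕ.m*n≢0 (64 ℕ.^ s) _ {{ℕ.m^n≢0 64 s}} {{ℕ.m^n≢0 4 m}}}}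

-- Each kept entry contributes at least `c` to the sum, each discarded one at least 0.
markov : {P : V → Set} (P? : ∀ x → Dec (P x)) (f : V → ℕ) (c : ℕ) → (∀ x → P x → c ℕ.≤ f x) →
  ∀ xs → length (filter P? xs) ℕ.* c ℕ.≤ sum (map f xs)
markov P? f c c≤f []       = z≤n
markov P? f c c≤f (x ∷ xs) with P? x
... | yes px = ℕ.+-mono-≤ (c≤f x px) (markov P? f c c≤f xs)
... | no _   = ℕ.m≤n⇒m≤o+n (f x) (markov P? f c c≤f xs)

low-count : ∀ n → length (lowExponents n) ℕ.* 100 ℕ.^ n ℕ.≤ 284 ℕ.^ n
-- The extra factor 100ⁿ raises the scale to the 10000ⁿ of the weights; on the right it comes back
-- out of 28400 = 284 · 100.
low-count n = ℕ.*-cancelʳ-≤ _ _ (100 ℕ.^ n) {{ℕ.m^n≢0 100 n}} (begin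
  length (lowExponents n) ℕ.* 100 ℕ.^ n ℕ.* 100 ℕ.^ n
    ≡⟨ ℕ.*-assoc (length (lowExponents n)) (100 ℕ.^ n) (100 ℕ.^ n) ⟩
  length (lowExponents n) ℕ.* (100 ℕ.^ n ℕ.* 100 ℕ.^ n)
    ≡⟨ cong (length (lowExponents n) ℕ.*_) (^-distribʳ-* 100 100 n) ⟨
  length (lowExponents n) ℕ.* 10000 ℕ.^ n
    ≤⟨ markov low? weight (10000 ℕ.^ n) low-weight (exponents n) ⟩
  sum (map weight (exponents n))
    ≡⟨ sum-weight n ⟩
  27721 ℕ.^ n
    ≤⟨ ℕ.^-monoˡ-≤ n (from-yes (27721 ℕ.≤? 28400)) ⟩
  28400 ℕ.^ n
    ≡⟨ ^-distribʳ-* 284 100 n ⟩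
  284 ℕ.^ n ℕ.* 100 ℕ.^ n ∎)
  where
  open ℕ.≤-Reasoning
  open ℕ-Solver.+-*-Solver using (solve; _:*_; _:=_)

  ^-distribʳ-* : ∀ b c n → (b ℕ.* c) ℕ.^ n ≡ b ℕ.^ n ℕ.* c ℕ.^ n
  ^-distribʳ-* b c zero    = refl
  ^-distribʳ-* b c (suc n) = trans (cong (b ℕ.* c ℕ.*_) (^-distribʳ-* b c n))
    (solve 4 (λ b c p q → b :* c :* (p :* q) := b :* p :* (c :* q)) refl b c (b ℕ.^ n) (c ℕ.^ n))

-- Transfer to the rationals.

-- `fromℕ` normalises by a gcd that does not reduce for variables, hence the detour through
-- unnormalised rationals.
fromℕ-* : ∀ m n → fromℕ (m ℕ.* n) ≡ fromℕ m * fromℕ n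
fromℕ-* m n = ℚ.toℚᵘ-injective (begin
  ℚ.toℚᵘ (fromℕ (m ℕ.* n))
    ≈⟨ ℚ.toℚᵘ-fromℚᵘ (ℚᵘ.mkℚᵘ (+ (m ℕ.* n)) 0) ⟩
  ℚᵘ.mkℚᵘ (+ (m ℕ.* n)) 0
    ≡⟨ cong (λ k → ℚᵘ.mkℚᵘ k 0) (ℤ.pos-* m n) ⟩
  ℚᵘ.mkℚᵘ (+ m) 0 ℚᵘ.* ℚᵘ.mkℚᵘ (+ n) 0
    ≈⟨ ℚᵘ.*-cong (ℚ.toℚᵘ-fromℚᵘ (ℚᵘ.mkℚᵘ (+ m) 0)) (ℚ.toℚᵘ-fromℚᵘ (ℚᵘ.mkℚᵘ (+ n) 0)) ⟨
  ℚ.toℚᵘ (fromℕ m) ℚᵘ.* ℚ.toℚᵘ (fromℕ n)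
    ≈⟨ ℚ.toℚᵘ-homo-* (fromℕ m) (fromℕ n) ⟨
  ℚ.toℚᵘ (fromℕ m * fromℕ n) ∎)
  where open ℚᵘ.≃-Reasoning

fromℕ-mono-≤ : ∀ {m n} → m ℕ.≤ n → fromℕ m ≤ fromℕ n
fromℕ-mono-≤ {m} {n} m≤n = ℚ.toℚᵘ-cancel-≤ (begin
  ℚ.toℚᵘ (fromℕ m)  ≃⟨ ℚ.toℚᵘ-fromℚᵘ (ℚᵘ.mkℚᵘ (+ m) 0) ⟩
  ℚᵘ.mkℚᵘ (+ m) 0   ≤⟨ ℚᵘ.*≤* (ℤ.*-monoʳ-≤-nonNeg (+ 1) (ℤ.+≤+ m≤n)) ⟩
  ℚᵘ.mkℚᵘ (+ n) 0   ≃⟨ ℚ.toℚᵘ-fromℚᵘ (ℚᵘ.mkℚᵘ (+ n) 0) ⟨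
  ℚ.toℚᵘ (fromℕ n)  ∎)
  where open ℚᵘ.≤-Reasoning

-- Meant for q = 284/100, whose normal form is 71/25: the hypothesis keeps the original numerator
-- and denominator available.
fromℕ-^ : ∀ {q} d p → q * fromℕ d ≡ fromℕ p → ∀ n → q ^ n * fromℕ (d ℕ.^ n) ≡ fromℕ (p ℕ.^ n)
fromℕ-^ d p eq zero = refl
fromℕ-^ {q} d p eq (suc n) = begin
  q * q ^ n * fromℕ (d ℕ.* d ℕ.^ n)
    ≡⟨ cong (q * q ^ n *_) (fromℕ-* d (d ℕ.^ n)) ⟩
  q * q ^ n * (fromℕ d * fromℕ (d ℕ.^ n))
    ≡⟨ interchange q (q ^ n) (fromℕ d) (fromℕ (d ℕ.^ n)) ⟩
  q * fromℕ d * (q ^ n * fromℕ (d ℕ.^ n))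
    ≡⟨ cong₂ _*_ eq (fromℕ-^ d p eq n) ⟩
  fromℕ p * fromℕ (p ℕ.^ n)
    ≡⟨ fromℕ-* p (p ℕ.^ n) ⟨
  fromℕ (p ℕ.^ suc n) ∎
  where
  open ≡-Reasoning
  open CommutativeSemigroupProperties (CommutativeMonoid.commutativeSemigroup ℚ.*-1-commutativeMonoid) using (interchange)

corollary1 : ∃[ K ] 0ℚ < K × (∀ (n : ℕ) .{{_ : NonZero n}} (A : FiniteSubset (𝔽₃^ n)) →
    AffineCap A → fromℕ ∣ A ∣ ≤ K * (+ 284 / 100) ^ n)
-- The constant 3 counts the three axes along which a slice may be taken.
corollary1 = fromℕ 3 , from-yes (0ℚ ℚ.<? fromℕ 3) , bound
  where
  open ℚ.≤-Reasoning

  bound : ∀ (n : ℕ) .{{_ : NonZero n}} (A : FiniteSubset (𝔽₃^ n)) →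
    AffineCap A → fromℕ ∣ A ∣ ≤ fromℕ 3 * (+ 284 / 100) ^ n
  -- Multiplying by 100ⁿ clears the denominators and leaves inequalities between natural numbers.
  bound n A cap = ℚ.*-cancelʳ-≤-pos (fromℕ (100 ℕ.^ n)) {{ℚ.normalize-pos (100 ℕ.^ n) 1 {{_}} {{ℕ.m^n≢0 100 n}}}} (begin
    fromℕ ∣ A ∣ * fromℕ (100 ℕ.^ n)
      ≡⟨ fromℕ-* ∣ A ∣ (100 ℕ.^ n) ⟨
    fromℕ (∣ A ∣ ℕ.* 100 ℕ.^ n)
      ≤⟨ fromℕ-mono-≤ (ℕ.*-monoˡ-≤ (100 ℕ.^ n) (cap-bound A cap)) ⟩
    fromℕ (3 ℕ.* length (lowExponents n) ℕ.* 100 ℕ.^ n)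
      ≡⟨ cong fromℕ (ℕ.*-assoc 3 (length (lowExponents n)) (100 ℕ.^ n)) ⟩
    fromℕ (3 ℕ.* (length (lowExponents n) ℕ.* 100 ℕ.^ n))
      ≤⟨ fromℕ-mono-≤ (ℕ.*-monoʳ-≤ 3 (low-count n)) ⟩
    fromℕ (3 ℕ.* 284 ℕ.^ n)
      ≡⟨ fromℕ-* 3 (284 ℕ.^ n) ⟩
    fromℕ 3 * fromℕ (284 ℕ.^ n)
      ≡⟨ cong (fromℕ 3 *_) (fromℕ-^ 100 284 refl n) ⟨
    fromℕ 3 * ((+ 284 / 100) ^ n * fromℕ (100 ℕ.^ n))
      ≡⟨ ℚ.*-assoc (fromℕ 3) ((+ 284 / 100) ^ n) (fromℕ (100 ℕ.^ n)) ⟨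
    fromℕ 3 * (+ 284 / 100) ^ n * fromℕ (100 ℕ.^ n) ∎)
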